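{- Let $r\ge1$, let $\mathbf{a}=\langle a_1,\dots,a_s\rangle$ be an integer vector with $s\le r+1$, and let $\mathbf{b}=\langle b_1\rangle$ with $b_1=a_1+\cdots+a_s$. Put $\delta=a_1\varepsilon_1+\cdots+a_s\varepsilon_s-b_1\varepsilon_{r+1}\in\mathbb{Z}^{r+1}$. Then the map sending a juggling sequence $S\in\mathrm{JS}(\mathbf{a},\mathbf{b},r)$ to the multiset of positive roots $\{\varepsilon_i-\varepsilon_{i+j}\}$, with $\varepsilon_i-\varepsilon_{i+j}$ taken with multiplicity equal to the number of throws at time $i$ to height $j$ in $S$, is a bijection from $\mathrm{JS}(\mathbf{a},\mathbf{b},r)$ onto $P_{A_r}(\delta)$.
   Context: A (magic) juggling state is a finitely supported integer vector $\mathbf{s}=\langle s_1,s_2,\dots\rangle$ indexed by heights $1,2,\dots$ (trailing zeros omitted). A juggling sequence of length $n$ from $\mathbf{a}$ to $\mathbf{b}$ is a sequence $(\mathbf{s}_0,\dots,\mathbf{s}_n)$ with $\mathbf{s}_0=\mathbf{a}$, $\mathbf{s}_n=\mathbf{b}$, such that for each $1\le i\le n$ there are nonnegative integers $c^{(i)}_1,c^{(i)}_2,\dots$ (finitely many nonzero) with $\sum_k c^{(i)}_k=(\mathbf{s}_{i-1})_1$ and $(\mathbf{s}_i)_k=(\mathbf{s}_{i-1})_{k+1}+c^{(i)}_k$ for all $k\ge1$; $c^{(i)}_j$ is the number of throws at time $i$ to height $j$. $\mathrm{JS}(\mathbf{a},\mathbf{b},n)$ denotes the set of these (no hand capacity constraint).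 For $r\ge1$, $\varepsilon_1,\dots,\varepsilon_{r+1}$ is the standard basis of $\mathbb{R}^{r+1}$ and $\Phi^+_{A_r}=\{\varepsilon_i-\varepsilon_j:1\le i<j\le r+1\}$. For $\mu\in\mathbb{Z}^{r+1}$ and $\Lambda\subseteq\Phi^+_{A_r}$, $P_\Lambda(\mu)$ is the set of finite multisets of elements of $\Lambda$ whose sum is $\mu$ (the empty multiset is a partition of $0$), $K_\Lambda(\mu)=|P_\Lambda(\mu)|$; for $\Lambda=\Phi^+_{A_r}$ we write $P_{A_r}$ and $K_{A_r}$ (Kostant's partition function). -}

-- Heights, times and coordinates are counted from 0 throughout: height k,
-- the i-th step and coordinate p below are height k + 1, time i + 1 and
-- coordinate p + 1 in the usual 1-based numbering.
module Defs where

open import Data.Bool.Base using (if_then_else_)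
open import Data.Fin.Base using (Fin; zero; suc; toℕ; fromℕ; inject₁)
open import Data.Integer.Base as ℤ using (ℤ; +_; 0ℤ; 1ℤ)
open import Data.List.Base using (List; applyUpTo; upTo; allFin; concatMap; replicate; foldr; map)
open import Data.List.Relation.Binary.Permutation.Propositional using (_↭_; ↭-setoid)
open import Data.List.Relation.Unary.All using (All)
open import Data.Nat.Base using (ℕ; zero; suc; _+_; _≤_; _<_; _≡ᵇ_; s≤s)
open import Data.Nat.ListAction using (sum)
open import Data.Product.Base using (Σ; _×_; _,_; proj₁; ∃-syntax)
open import Data.Vec.Base as Vec using (Vec; []; _∷_)
open import Level using (0ℓ)
open import Relation.Binary.Bundles using (Setoid)
open import Relation.Binary.Construct.On as On using ()
open import Relation.Binary.PropositionalEquality using (_≡_; refl; sym; trans)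
open import Relation.Unary using (Pred)

------------------------------------------------------------------------
-- Juggling states

record FinSupp (A : Set) (z : A) : Set where
  field
    at      : ℕ → A
    bound   : ℕ
    support : ∀ k → bound ≤ k → at k ≡ z

open FinSupp public

-- Two states are the same when their entries agree; the bound on the
-- support is not part of the state's identity.
State : Set
State = FinSupp ℤ 0ℤ

_≋_ : State → State → Set
s ≋ t = ∀ k → at s k ≡ at t k

entry : ∀ {s} → Vec ℤ s → ℕ → ℤ
entry []       _       = 0ℤ
entry (x ∷ xs) zero    = x
entry (x ∷ xs) (suc k) = entry xs k

entry-support : ∀ {s} (a : Vec ℤ s) k → s ≤ k → entry a k ≡ 0ℤ
entry-support []       _       _         = refl
entry-support (x ∷ xs) (suc k) (s≤s s≤k) = entry-support xs k s≤k

⟨_⟩ : ∀ {s} → Vec ℤ s → State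
⟨_⟩ {s} a = record { at = entry a ; bound = s ; support = entry-support a }

------------------------------------------------------------------------
-- Juggling sequences

-- The numbers of throws to each height at one moment.
Throws : Set
Throws = FinSupp ℕ 0

total : Throws → ℕ
total c = sum (applyUpTo (at c) (bound c))

record Step (s t : State) : Set where
  field
    throws : Throws
    thrown : + total throws ≡ at s 0
    landed : ∀ k → at t k ≡ at s (suc k) ℤ.+ + at throws k

open Step public

record JugglingSeq (a b : State) (n : ℕ) : Set where
  field
    state : Fin (suc n) → State
    start : state zero ≋ a
    end   : state (fromℕ n) ≋ b
    step  : (i : Fin n) → Step (state (inject₁ i)) (state (suc i))

open JugglingSeq public

-- A juggling sequence is its sequence of states, so equality ignores the
-- throws (which the states determine).
JS : State → State → ℕ → Setoid 0ℓ 0ℓ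
JS a b n = record
  { Carrier       = JugglingSeq a b n
  ; _≈_           = λ S T → ∀ i → state S i ≋ state T i
  ; isEquivalence = record
    { refl  = λ _ _ → refl
    ; sym   = λ p i k → sym (p i k)
    ; trans = λ p q i k → trans (p i k) (q i k)
    }
  }

throwsAt : ∀ {a b n} → JugglingSeq a b n → Fin n → Throws
throwsAt S i = throws (step S i)

------------------------------------------------------------------------
-- Integer vectors and type A roots

0ᵛ : ∀ {n} → Vec ℤ n
0ᵛ = Vec.replicate _ 0ℤ

_+ᵛ_ _-ᵛ_ : ∀ {n} → Vec ℤ n → Vec ℤ n → Vec ℤ n
_+ᵛ_ = Vec.zipWith ℤ._+_
_-ᵛ_ = Vec.zipWith ℤ._-_

_·ᵛ_ : ∀ {n} → ℤ → Vec ℤ n → Vec ℤ n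
x ·ᵛ v = Vec.map (x ℤ.*_) v

infixl 6 _+ᵛ_ _-ᵛ_
infixl 7 _·ᵛ_

sumᵛ : ∀ {n} → List (Vec ℤ n) → Vec ℤ n
sumᵛ = foldr _+ᵛ_ 0ᵛ

-- For an index i ≥ n this is the zero vector, so ε i -ᵛ ε j with
-- i < n ≤ j is not a positive root.
ε : ∀ {n} → ℕ → Vec ℤ n
ε i = Vec.tabulate λ p → if toℕ p ≡ᵇ i then 1ℤ else 0ℤ

Φ⁺ : (r : ℕ) → Pred (Vec ℤ (suc r)) 0ℓ
Φ⁺ r v = ∃[ i ] ∃[ j ] (i < j × j < suc r × v ≡ ε i -ᵛ ε j)

------------------------------------------------------------------------
-- Vector partitions

-- Finite multisets are lists up to permutation.
IsPartition : ∀ {n} → Pred (Vec ℤ n) 0ℓ → Vec ℤ n → List (Vec ℤ n) → Set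
IsPartition Λ μ ps = All Λ ps × sumᵛ ps ≡ μ

P : ∀ {n} → Pred (Vec ℤ n) 0ℓ → Vec ℤ n → Setoid 0ℓ 0ℓ
P {n} Λ μ = record
  { Carrier       = Σ (List (Vec ℤ n)) (IsPartition Λ μ)
  ; _≈_           = λ p q → proj₁ p ↭ proj₁ q
  ; isEquivalence = On.isEquivalence proj₁ (Setoid.isEquivalence ↭-setoid)
  }

------------------------------------------------------------------------
-- From juggling sequences to partitions

-- The 1-based ε_i − ε_{i+j} with i = toℕ i + 1, j = j + 1 is
-- ε (toℕ i) -ᵛ ε (toℕ i + suc j) here. All throws are included, also any
-- that would land after time r + 1.
rootMultiset : ∀ {a b r} → JugglingSeq a b r → List (Vec ℤ (suc r))
rootMultiset {r = r} S =
  concatMap (λ i →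
    concatMap (λ j →
      replicate (at (throwsAt S i) j) (ε (toℕ i) -ᵛ ε (toℕ i + suc j)))
    (upTo (bound (throwsAt S i))))
  (allFin r)

sumℤ : ∀ {s} → Vec ℤ s → ℤ
sumℤ = Vec.foldr′ ℤ._+_ 0ℤ

δ : ∀ {s} (r : ℕ) → Vec ℤ s → ℤ → Vec ℤ (suc r)
δ {s} r a b₁ =
  sumᵛ (map (λ i → Vec.lookup a i ·ᵛ ε (toℕ i)) (allFin s))
    -ᵛ b₁ ·ᵛ ε r

{-# OPTIONS --safe #-}
-- Write c i j for the number of throws of height j at time i, and let net c p
-- be coordinate p of the sum of the corresponding roots: the balls thrown at
-- time p minus the balls landing at time p. Unrolling the recursion for the
-- states, c drives a to b in n steps if and only if net c p = aₚ − bₚ₋ₙ for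
-- every p, where b vanishes at negative indices. When b = ⟨b₁⟩ and a has no
-- entries beyond coordinate r, this forces net c p = 0 for p > r, where
-- nothing is thrown; so no ball lands after time r, all the vectors are
-- positive roots, and what remains is the equation saying that they sum to δ.
-- Since ε_i − ε_j determines i and j, c can be read off the multiset as its
-- multiplicities.
module Submission where

open import Defs
open import Algebra.Bundles using (AbelianGroup)
open import Data.Bool.Base using (true; false; if_then_else_)
open import Data.Fin.Base using (Fin; zero; suc; toℕ; fromℕ; fromℕ<; inject₁)
open import Data.Fin.Induction using (<-weakInduction)
open import Data.Fin.Properties using (toℕ<n; toℕ-fromℕ<)
open import Data.Integer.Base as ℤ using (ℤ; +_; 0ℤ; 1ℤ; -_; _-_)
import Data.Integer.Properties as ℤ
open import Data.Integer.Tactic.RingSolver using (solve-∀)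
open import Data.List.Base
  using (List; []; _∷_; _++_; concatMap; replicate; map; allFin; applyUpTo; upTo; filter; length)
open import Data.List.Membership.Propositional using (_∈_)
open import Data.List.Membership.Propositional.Properties using (∈-∃++)
import Data.List.Membership.DecPropositional as DecMembership
open import Data.List.Properties
  using (filter-accept; filter-none; map-tabulate; map-applyUpTo)
open import Data.List.Relation.Binary.Permutation.Propositional as ↭
  using (_↭_; ↭-sym; ↭-trans; prep)
open import Data.List.Relation.Binary.Permutation.Propositional.Properties
  using (↭-length; filter-↭; shift; All-resp-↭)
open import Data.List.Relation.Unary.All as All using (All; []; _∷_)
import Data.List.Relation.Unary.All.Properties as All
open import Data.Nat.Base using (ℕ; zero; suc; _+_; _∸_; _≤_; _<_; _≡ᵇ_; z≤n; s≤s; _⊔_)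
open import Data.Nat.ListAction using (sum)
import Data.Nat.Properties as ℕ
open import Data.Product.Base using (Σ; _×_; _,_; proj₁; proj₂)
open import Data.Sum.Base using (_⊎_; inj₁; inj₂)
open import Data.Vec.Base using (Vec; []; _∷_; lookup)
import Data.Vec.Properties as Vec
open import Data.Vec.Relation.Binary.Pointwise.Extensional using (ext; Pointwise-≡⇒≡)
open import Function.Base using (_∘_; id)
open import Function.Structures using (IsBijection)
open import Level using (0ℓ)
open import Relation.Binary.Bundles using (Setoid)
open import Relation.Binary.Definitions using (DecidableEquality)
open import Relation.Binary.PropositionalEquality
open import Relation.Nullary using (does; yes; no; contradiction)
open import Relation.Unary using (Pred)

open import Algebra.Properties.Group (AbelianGroup.group ℤ.+-0-abelianGroup) using (∙-cancelˡ)

open ≡-Reasoning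

private
  variable
    A B : Set

-- Sums over lists

sumOf : (A → ℤ) → List A → ℤ
sumOf f []       = 0ℤ
sumOf f (x ∷ xs) = f x ℤ.+ sumOf f xs

sumOf-cong : {f g : A → ℤ} → f ≗ g → sumOf f ≗ sumOf g
sumOf-cong f≗g []       = refl
sumOf-cong f≗g (x ∷ xs) = cong₂ ℤ._+_ (f≗g x) (sumOf-cong f≗g xs)

sumOf-zero : {f : A → ℤ} → (∀ x → f x ≡ 0ℤ) → ∀ xs → sumOf f xs ≡ 0ℤ
sumOf-zero f≡0 []       = refl
sumOf-zero f≡0 (x ∷ xs) = cong₂ ℤ._+_ (f≡0 x) (sumOf-zero f≡0 xs)

sumOf-neg : (f : A → ℤ) → ∀ xs → sumOf (λ x → - f x) xs ≡ - sumOf f xs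
sumOf-neg f []       = refl
sumOf-neg f (x ∷ xs) =
  trans (cong (ℤ._+_ (- f x)) (sumOf-neg f xs)) (sym (ℤ.neg-distrib-+ (f x) (sumOf f xs)))

sumOf-++ : (f : A → ℤ) → ∀ xs ys → sumOf f (xs ++ ys) ≡ sumOf f xs ℤ.+ sumOf f ys
sumOf-++ f []       ys = sym (ℤ.+-identityˡ _)
sumOf-++ f (x ∷ xs) ys =
  trans (cong (ℤ._+_ (f x)) (sumOf-++ f xs ys)) (sym (ℤ.+-assoc (f x) _ _))

sumOf-map : (f : B → ℤ) (g : A → B) → ∀ xs → sumOf f (map g xs) ≡ sumOf (f ∘ g) xs
sumOf-map f g []       = refl
sumOf-map f g (x ∷ xs) = cong (ℤ._+_ (f (g x))) (sumOf-map f g xs)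

sumOf-concatMap : (f : B → ℤ) (g : A → List B) → ∀ xs →
                  sumOf f (concatMap g xs) ≡ sumOf (sumOf f ∘ g) xs
sumOf-concatMap f g []       = refl
sumOf-concatMap f g (x ∷ xs) =
  trans (sumOf-++ f (g x) (concatMap g xs)) (cong (ℤ._+_ (sumOf f (g x))) (sumOf-concatMap f g xs))

sumOf-replicate : (f : A → ℤ) → ∀ n x → sumOf f (replicate n x) ≡ + n ℤ.* f x
sumOf-replicate f zero    x = sym (ℤ.*-zeroˡ (f x))
sumOf-replicate f (suc n) x =
  trans (cong (ℤ._+_ (f x)) (sumOf-replicate f n x)) (sym (ℤ.suc-* (+ n) (f x)))

sumOf-↭ : (f : A → ℤ) {xs ys : List A} → xs ↭ ys → sumOf f xs ≡ sumOf f ys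
sumOf-↭ f ↭.refl         = refl
sumOf-↭ f (prep x p)     = cong (ℤ._+_ (f x)) (sumOf-↭ f p)
sumOf-↭ f (↭.swap x y p) =
  trans (cong (λ z → f x ℤ.+ (f y ℤ.+ z)) (sumOf-↭ f p)) (exchange (f x) (f y) _)
  where
  exchange : ∀ i j k → i ℤ.+ (j ℤ.+ k) ≡ j ℤ.+ (i ℤ.+ k)
  exchange = solve-∀
sumOf-↭ f (↭.trans p q)  = trans (sumOf-↭ f p) (sumOf-↭ f q)

sumOf-allFin-suc : ∀ {n} (f : Fin (suc n) → ℤ) →
                   sumOf f (allFin (suc n)) ≡ f zero ℤ.+ sumOf (f ∘ suc) (allFin n)
sumOf-allFin-suc f =
  cong (ℤ._+_ (f zero))
    (trans (cong (sumOf f) (sym (map-tabulate id suc))) (sumOf-map f suc (allFin _)))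

sumOf-upTo-suc : ∀ (f : ℕ → ℤ) n → sumOf f (upTo (suc n)) ≡ f 0 ℤ.+ sumOf (f ∘ suc) (upTo n)
sumOf-upTo-suc f n =
  cong (ℤ._+_ (f 0))
    (trans (cong (sumOf f) (sym (map-applyUpTo id suc n))) (sumOf-map f suc (upTo n)))

-- Kronecker delta

kron : ℕ → ℕ → ℤ
kron p i = if p ≡ᵇ i then 1ℤ else 0ℤ

kron-refl : ∀ p → kron p p ≡ 1ℤ
kron-refl zero    = refl
kron-refl (suc p) = kron-refl p

kron-≢ : ∀ {p i} → p ≢ i → kron p i ≡ 0ℤ
kron-≢ {zero}  {zero}  p≢i = contradiction refl p≢i
kron-≢ {zero}  {suc i} p≢i = refl
kron-≢ {suc p} {zero}  p≢i = refl
kron-≢ {suc p} {suc i} p≢i = kron-≢ (p≢i ∘ cong suc)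

kron-0-1 : ∀ p i → kron p i ≡ 0ℤ ⊎ kron p i ≡ 1ℤ
kron-0-1 p i with p ≡ᵇ i
... | true  = inj₂ refl
... | false = inj₁ refl

-- Truncating at `n` loses nothing: for `p` at or past `n` every Kronecker factor is zero, and so is
-- `u p`.
sumOf-upTo-kron : ∀ (u : ℕ → ℕ) n → (∀ k → n ≤ k → u k ≡ 0) → ∀ p →
                  sumOf (λ j → + u j ℤ.* kron p j) (upTo n) ≡ + u p
sumOf-upTo-kron u zero    u≡0 p       = cong +_ (sym (u≡0 p z≤n))
sumOf-upTo-kron u (suc n) u≡0 zero    = begin
  sumOf (λ j → + u j ℤ.* kron 0 j) (upTo (suc n))
    ≡⟨ sumOf-upTo-suc (λ j → + u j ℤ.* kron 0 j) n ⟩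
  + u 0 ℤ.* 1ℤ ℤ.+ sumOf (λ j → + u (suc j) ℤ.* 0ℤ) (upTo n)
    ≡⟨ cong₂ ℤ._+_ (ℤ.*-identityʳ (+ u 0)) (sumOf-zero (ℤ.*-zeroʳ ∘ +_ ∘ u ∘ suc) (upTo n)) ⟩
  + u 0 ℤ.+ 0ℤ
    ≡⟨ ℤ.+-identityʳ (+ u 0) ⟩
  + u 0 ∎
sumOf-upTo-kron u (suc n) u≡0 (suc p) = begin
  sumOf (λ j → + u j ℤ.* kron (suc p) j) (upTo (suc n))
    ≡⟨ sumOf-upTo-suc (λ j → + u j ℤ.* kron (suc p) j) n ⟩
  + u 0 ℤ.* 0ℤ ℤ.+ sumOf (λ j → + u (suc j) ℤ.* kron p j) (upTo n)
    ≡⟨ cong₂ ℤ._+_ (ℤ.*-zeroʳ (+ u 0))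
         (sumOf-upTo-kron (u ∘ suc) n (λ k n≤k → u≡0 (suc k) (s≤s n≤k)) p) ⟩
  0ℤ ℤ.+ + u (suc p)
    ≡⟨ ℤ.+-identityˡ _ ⟩
  + u (suc p) ∎

sumOf-lookup-kron : ∀ {s} (a : Vec ℤ s) p →
                    sumOf (λ i → lookup a i ℤ.* kron p (toℕ i)) (allFin s) ≡ entry a p
sumOf-lookup-kron []       p       = refl
sumOf-lookup-kron {suc s} (x ∷ a) zero    = begin
  sumOf (λ i → lookup (x ∷ a) i ℤ.* kron 0 (toℕ i)) (allFin (suc s))
    ≡⟨ sumOf-allFin-suc (λ i → lookup (x ∷ a) i ℤ.* kron 0 (toℕ i)) ⟩
  x ℤ.* 1ℤ ℤ.+ sumOf (λ i → lookup a i ℤ.* 0ℤ) (allFin s)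
    ≡⟨ cong₂ ℤ._+_ (ℤ.*-identityʳ x) (sumOf-zero (ℤ.*-zeroʳ ∘ lookup a) (allFin s)) ⟩
  x ℤ.+ 0ℤ
    ≡⟨ ℤ.+-identityʳ x ⟩
  x ∎
sumOf-lookup-kron {suc s} (x ∷ a) (suc p) = begin
  sumOf (λ i → lookup (x ∷ a) i ℤ.* kron (suc p) (toℕ i)) (allFin (suc s))
    ≡⟨ sumOf-allFin-suc (λ i → lookup (x ∷ a) i ℤ.* kron (suc p) (toℕ i)) ⟩
  x ℤ.* 0ℤ ℤ.+ sumOf (λ i → lookup a i ℤ.* kron p (toℕ i)) (allFin s)
    ≡⟨ cong₂ ℤ._+_ (ℤ.*-zeroʳ x) (sumOf-lookup-kron a p) ⟩
  0ℤ ℤ.+ entry a p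
    ≡⟨ ℤ.+-identityˡ _ ⟩
  entry a p ∎

-- Multiplicities

module Multiplicity (_≟_ : DecidableEquality A) where

  open DecMembership _≟_ using (_∈?_)

  count : A → List A → ℕ
  count x = length ∘ filter (x ≟_)

  count-∷-≡ : ∀ x xs → count x (x ∷ xs) ≡ suc (count x xs)
  count-∷-≡ x xs = cong length (filter-accept (x ≟_) refl)

  count-∉ : ∀ {x xs} → (∀ {y} → y ∈ xs → x ≢ y) → count x xs ≡ 0
  count-∉ x∉xs = cong length (filter-none (_ ≟_) (All.tabulate x∉xs))

  count-↭ : ∀ x {xs ys} → xs ↭ ys → count x xs ≡ count x ys
  count-↭ x = ↭-length ∘ filter-↭ (x ≟_)

  count-∷-cancel : ∀ x {y xs ys} → count x (y ∷ xs) ≡ count x (y ∷ ys) → count x xs ≡ count x ys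
  count-∷-cancel x {y} eq with x ≟ y
  ... | yes _ = ℕ.suc-injective eq
  ... | no  _ = eq

  -- Integer-valued, so that multiplicities become instances of `sumOf` and are computed by the same
  -- lemma as coordinates of sums.
  indicator : A → A → ℤ
  indicator x y = if does (x ≟ y) then 1ℤ else 0ℤ

  indicator-refl : ∀ x → indicator x x ≡ 1ℤ
  indicator-refl x with x ≟ x
  ... | yes _  = refl
  ... | no x≢x = contradiction refl x≢x

  indicator-≢ : ∀ {x y} → x ≢ y → indicator x y ≡ 0ℤ
  indicator-≢ {x} {y} x≢y with x ≟ y
  ... | yes x≡y = contradiction x≡y x≢y
  ... | no _    = refl

  sumOf-indicator : ∀ x xs → sumOf (indicator x) xs ≡ + count x xs
  sumOf-indicator x []       = refl
  sumOf-indicator x (y ∷ ys) with x ≟ y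
  ... | yes _ = cong (ℤ._+_ 1ℤ) (sumOf-indicator x ys)
  ... | no  _ = trans (ℤ.+-identityˡ _) (sumOf-indicator x ys)

  -- The head of `xs` has positive count, so it occurs in `ys`; move it to the front there and
  -- cancel. Counts are compared only where `Q` holds because multiplicities of `roots c` are known
  -- only at positive roots.
  count≡⇒↭ : ∀ {Q : Pred A 0ℓ} {xs ys} → All Q xs → All Q ys →
             (∀ x → Q x → count x xs ≡ count x ys) → xs ↭ ys
  count≡⇒↭ {xs = []} {[]}     []       []       eq = ↭.refl
  count≡⇒↭ {xs = []} {y ∷ ys} []       (qy ∷ _) eq
    with () ← trans (eq y qy) (count-∷-≡ y ys)
  count≡⇒↭ {xs = x ∷ xs} {ys} (qx ∷ qxs) qys    eq with x ∈? ys
  ... | no x∉ys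
    with () ← trans (sym (count-∷-≡ x xs))
                (trans (eq x qx) (count-∉ λ { y∈ys refl → x∉ys y∈ys }))
  ... | yes x∈ys with us , vs , refl ← ∈-∃++ x∈ys =
    ↭-trans (prep x (count≡⇒↭ qxs (All.tail (All-resp-↭ moved qys)) tail-eq)) (↭-sym moved)
    where
    moved : us ++ x ∷ vs ↭ x ∷ us ++ vs
    moved = shift x us vs

    tail-eq : ∀ v → _ → count v xs ≡ count v (us ++ vs)
    tail-eq v qv = count-∷-cancel v (trans (eq v qv) (count-↭ v moved))

-- Roots

root : ∀ {n} → ℕ → ℕ → Vec ℤ n
root i j = ε i -ᵛ ε j

lookup-ε : ∀ {n} i (p : Fin n) → lookup (ε i) p ≡ kron (toℕ p) i
lookup-ε i p = Vec.lookup∘tabulate _ p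

lookup-root : ∀ {n} i j (p : Fin n) → lookup (root i j) p ≡ kron (toℕ p) i - kron (toℕ p) j
lookup-root i j p =
  trans (Vec.lookup-zipWith _-_ p (ε i) (ε j)) (cong₂ _-_ (lookup-ε i p) (lookup-ε j p))

-- Coordinate `i` is 1 on the left, but 0 or -1 on the right unless `i ≡ i′`. Coordinate `j′` is -1
-- on the right, but 0 or 1 on the left unless `j ≡ j′`. The index `j` may lie out of range, where
-- `ε j` is zero; this lets the lemma separate late throws from positive roots.
root-injective : ∀ {n i j i′ j′} → i < n → j′ < n → i < j → i′ < j′ →
                 root {n} i j ≡ root i′ j′ → i ≡ i′ × j ≡ j′
root-injective {n} {i} {j} {i′} {j′} i<n j′<n i<j i′<j′ eq = i≡i′ , j≡j′
  where
  coordinate : ∀ {p} → p < n → kron p i - kron p j ≡ kron p i′ - kron p j′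
  coordinate {p} p<n = subst (λ p → kron p i - kron p j ≡ kron p i′ - kron p j′)
    (toℕ-fromℕ< p<n)
    (trans (sym (lookup-root i j (fromℕ< p<n)))
      (trans (cong (λ v → lookup v (fromℕ< p<n)) eq) (lookup-root i′ j′ (fromℕ< p<n))))

  i≡i′ : i ≡ i′
  i≡i′ with i ℕ.≟ i′
  ... | yes p = p
  ... | no i≢i′ with coordinate i<n
  ... | e rewrite kron-refl i | kron-≢ (ℕ.<⇒≢ i<j) | kron-≢ i≢i′ with kron-0-1 i j′
  ... | inj₁ z rewrite z with () ← e
  ... | inj₂ z rewrite z with () ← e

  j≡j′ : j ≡ j′
  j≡j′ with j′ ℕ.≟ j
  ... | yes p = sym p
  ... | no j′≢j with coordinate j′<n
  ... | e rewrite kron-refl j′ | kron-≢ (ℕ.>⇒≢ i′<j′) | kron-≢ j′≢j with kron-0-1 j′ i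
  ... | inj₁ z rewrite z with () ← e
  ... | inj₂ z rewrite z with () ← e

lookup-sumᵛ : ∀ {n} (xs : List (Vec ℤ n)) p → lookup (sumᵛ xs) p ≡ sumOf (λ v → lookup v p) xs
lookup-sumᵛ []       p = Vec.lookup-replicate p 0ℤ
lookup-sumᵛ (x ∷ xs) p =
  trans (Vec.lookup-zipWith ℤ._+_ p x (sumᵛ xs)) (cong (ℤ._+_ (lookup x p)) (lookup-sumᵛ xs p))

lookup-ext : ∀ {n} {u v : Vec ℤ n} → (∀ p → lookup u p ≡ lookup v p) → u ≡ v
lookup-ext eq = Pointwise-≡⇒≡ (ext eq)

sumᵛ-↭ : ∀ {n} {xs ys : List (Vec ℤ n)} → xs ↭ ys → sumᵛ xs ≡ sumᵛ ys
sumᵛ-↭ {xs = xs} {ys} xs↭ys = lookup-ext λ p →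
  trans (lookup-sumᵛ xs p)
    (trans (sumOf-↭ (λ v → lookup v p) xs↭ys) (sym (lookup-sumᵛ ys p)))

lookup-δ : ∀ {s} r (a : Vec ℤ s) b p →
           lookup (δ r a b) p ≡ entry a (toℕ p) - b ℤ.* kron (toℕ p) r
lookup-δ {s} r a b p =
  trans (Vec.lookup-zipWith _-_ p (sumᵛ terms) (b ·ᵛ ε r)) (cong₂ _-_ first (scaled b r))
  where
  terms : List (Vec ℤ (suc r))
  terms = map (λ i → lookup a i ·ᵛ ε (toℕ i)) (allFin s)

  scaled : ∀ x i → lookup (x ·ᵛ ε {suc r} i) p ≡ x ℤ.* kron (toℕ p) i
  scaled x i = trans (Vec.lookup-map p _ (ε i)) (cong (ℤ._*_ x) (lookup-ε i p))

  first : lookup (sumᵛ terms) p ≡ entry a (toℕ p)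
  first = begin
    lookup (sumᵛ terms) p
      ≡⟨ lookup-sumᵛ terms p ⟩
    sumOf (λ v → lookup v p) terms
      ≡⟨ sumOf-map (λ v → lookup v p) _ (allFin s) ⟩
    sumOf (λ i → lookup (lookup a i ·ᵛ ε (toℕ i)) p) (allFin s)
      ≡⟨ sumOf-cong (λ i → scaled (lookup a i) (toℕ i)) (allFin s) ⟩
    sumOf (λ i → lookup a i ℤ.* kron (toℕ p) (toℕ i)) (allFin s)
      ≡⟨ sumOf-lookup-kron a (toℕ p) ⟩
    entry a (toℕ p) ∎

-- Sums over the throws

pairing : Throws → (ℕ → ℤ) → ℤ
pairing c g = sumOf (λ j → + at c j ℤ.* g j) (upTo (bound c))

pairing-cong : ∀ c {g h : ℕ → ℤ} → g ≗ h → pairing c g ≡ pairing c h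
pairing-cong c g≗h = sumOf-cong (λ j → cong (ℤ._*_ (+ at c j)) (g≗h j)) (upTo (bound c))

pairing-zero : ∀ c {g : ℕ → ℤ} → (∀ j → g j ≡ 0ℤ) → pairing c g ≡ 0ℤ
pairing-zero c g≡0 =
  sumOf-zero (λ j → trans (cong (ℤ._*_ (+ at c j)) (g≡0 j)) (ℤ.*-zeroʳ (+ at c j))) (upTo (bound c))

pairing-kron : ∀ c p → pairing c (kron p) ≡ + at c p
pairing-kron c = sumOf-upTo-kron (at c) (bound c) (support c)

pairing-neg-kron : ∀ c p → pairing c (λ j → - kron p j) ≡ - + at c p
pairing-neg-kron c p = begin
  pairing c (λ j → - kron p j)
    ≡⟨ sumOf-cong (λ j → sym (ℤ.neg-distribʳ-* (+ at c j) (kron p j))) (upTo (bound c)) ⟩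
  sumOf (λ j → - (+ at c j ℤ.* kron p j)) (upTo (bound c))
    ≡⟨ sumOf-neg (λ j → + at c j ℤ.* kron p j) (upTo (bound c)) ⟩
  - pairing c (kron p)
    ≡⟨ cong -_ (pairing-kron c p) ⟩
  - + at c p ∎

pairing-1 : ∀ c → pairing c (λ _ → 1ℤ) ≡ + total c
pairing-1 c = go (at c) (bound c)
  where
  go : ∀ (u : ℕ → ℕ) n →
       sumOf (λ j → + u j ℤ.* 1ℤ) (upTo n) ≡ + sum (applyUpTo u n)
  go u zero    = refl
  go u (suc n) = trans (sumOf-upTo-suc (λ j → + u j ℤ.* 1ℤ) n)
    (cong₂ ℤ._+_ (ℤ.*-identityʳ (+ u 0)) (go (u ∘ suc) n))

-- The summand is given the time of a throw and the time at which it lands,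
-- which are the indices of its root.
throwSum : ∀ {n} → (ℕ → ℕ → ℤ) → (Fin n → Throws) → ℤ
throwSum {n} f c = sumOf (λ i → pairing (c i) (λ j → f (toℕ i) (toℕ i + suc j))) (allFin n)

throwSum-suc : ∀ {n} f (c : Fin (suc n) → Throws) →
               throwSum f c ≡ pairing (c zero) (λ j → f 0 (suc j))
                                ℤ.+ throwSum (λ i j → f (suc i) (suc j)) (c ∘ suc)
throwSum-suc f c = sumOf-allFin-suc (λ i → pairing (c i) (λ j → f (toℕ i) (toℕ i + suc j)))

throwSum-zero : ∀ {n} {f} (c : Fin n → Throws) → (∀ i j → f i j ≡ 0ℤ) → throwSum f c ≡ 0ℤ
throwSum-zero c f≡0 = sumOf-zero (λ i → pairing-zero (c i) (λ j → f≡0 _ _)) (allFin _)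

-- The time of a throw and its landing time determine its height, so the two Kronecker factors
-- select a single entry of `c`.
throwSum-kron : ∀ {n} (c : Fin n → Throws) i j →
  throwSum (λ k l → kron (toℕ i) k ℤ.* kron (toℕ i + suc j) l) c ≡ + at (c i) j
throwSum-kron c zero j = begin
  throwSum (λ k l → kron 0 k ℤ.* kron (suc j) l) c
    ≡⟨ throwSum-suc (λ k l → kron 0 k ℤ.* kron (suc j) l) c ⟩
  pairing (c zero) (λ l → 1ℤ ℤ.* kron j l) ℤ.+ throwSum (λ k l → 0ℤ ℤ.* kron j l) (c ∘ suc)
    ≡⟨ cong₂ ℤ._+_
         (trans (pairing-cong (c zero) (λ l → ℤ.*-identityˡ (kron j l))) (pairing-kron (c zero) j))
         (throwSum-zero (c ∘ suc) (λ _ l → ℤ.*-zeroˡ (kron j l))) ⟩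
  + at (c zero) j ℤ.+ 0ℤ
    ≡⟨ ℤ.+-identityʳ _ ⟩
  + at (c zero) j ∎
throwSum-kron c (suc i) j = begin
  throwSum (λ k l → kron (suc (toℕ i)) k ℤ.* kron (suc (toℕ i + suc j)) l) c
    ≡⟨ throwSum-suc (λ k l → kron (suc (toℕ i)) k ℤ.* kron (suc (toℕ i + suc j)) l) c ⟩
  pairing (c zero) (λ l → 0ℤ ℤ.* kron (toℕ i + suc j) l)
    ℤ.+ throwSum (λ k l → kron (toℕ i) k ℤ.* kron (toℕ i + suc j) l) (c ∘ suc)
    ≡⟨ cong₂ ℤ._+_ (pairing-zero (c zero) (λ l → ℤ.*-zeroˡ (kron (toℕ i + suc j) l)))
                   (throwSum-kron (c ∘ suc) i j) ⟩
  0ℤ ℤ.+ + at (c (suc i)) j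
    ≡⟨ ℤ.+-identityˡ _ ⟩
  + at (c (suc i)) j ∎

-- Net flow and late landings

net : ∀ {n} → (Fin n → Throws) → ℕ → ℤ
net c p = throwSum (λ i j → kron p i - kron p j) c

-- Landing times have the form `i + suc j`, so nothing lands at time 0, and later steps do not throw
-- then.
net-0 : ∀ {n} (c : Fin (suc n) → Throws) → net c 0 ≡ + total (c zero)
net-0 c = begin
  net c 0
    ≡⟨ throwSum-suc (λ i j → kron 0 i - kron 0 j) c ⟩
  pairing (c zero) (λ _ → 1ℤ) ℤ.+ throwSum (λ _ _ → 0ℤ) (c ∘ suc)
    ≡⟨ cong₂ ℤ._+_ (pairing-1 (c zero)) (throwSum-zero (c ∘ suc) (λ _ _ → refl)) ⟩
  + total (c zero) ℤ.+ 0ℤ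
    ≡⟨ ℤ.+-identityʳ _ ⟩
  + total (c zero) ∎

-- Dropping the first step shifts time by one; what it contributes after time 0 is the landing at
-- `suc p` of its throws to height `p`. This mirrors the recursion in `landed`.
net-suc : ∀ {n} (c : Fin (suc n) → Throws) p →
          net c (suc p) ≡ net (c ∘ suc) p - + at (c zero) p
net-suc c p = begin
  net c (suc p)
    ≡⟨ throwSum-suc (λ i j → kron (suc p) i - kron (suc p) j) c ⟩
  pairing (c zero) (λ j → 0ℤ - kron p j) ℤ.+ net (c ∘ suc) p
    ≡⟨ cong (ℤ._+ net (c ∘ suc) p)
         (trans (pairing-cong (c zero) (λ j → ℤ.+-identityˡ (- kron p j)))
                (pairing-neg-kron (c zero) p)) ⟩
  - + at (c zero) p ℤ.+ net (c ∘ suc) p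
    ≡⟨ ℤ.+-comm (- + at (c zero) p) _ ⟩
  net (c ∘ suc) p - + at (c zero) p ∎

-- Only throws made before time n are recorded, so from time n on the net flow
-- consists of landings.
arrivals : ∀ {n} → (Fin n → Throws) → ℕ → ℕ
arrivals {zero}  c p       = 0
arrivals {suc n} c zero    = 0
arrivals {suc n} c (suc p) = at (c zero) p + arrivals (c ∘ suc) p

net-late : ∀ {n} (c : Fin n → Throws) {p} → n ≤ p → net c p ≡ - + arrivals c p
net-late {zero}  c _ = refl
net-late {suc n} c {suc p} (s≤s n≤p) = begin
  net c (suc p)
    ≡⟨ net-suc c p ⟩
  net (c ∘ suc) p - + at (c zero) p
    ≡⟨ cong (_- + at (c zero) p) (net-late (c ∘ suc) n≤p) ⟩
  - + arrivals (c ∘ suc) p - + at (c zero) p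
    ≡⟨ -x-y≡-[y+x] (+ arrivals (c ∘ suc) p) (+ at (c zero) p) ⟩
  - + arrivals c (suc p) ∎
  where
  -x-y≡-[y+x] : ∀ x y → - x - y ≡ - (y ℤ.+ x)
  -x-y≡-[y+x] = solve-∀

throws≤arrivals : ∀ {n} (c : Fin n → Throws) i j → at (c i) j ≤ arrivals c (suc (toℕ i + j))
throws≤arrivals c zero    j = ℕ.m≤m+n _ _
throws≤arrivals c (suc i) j = ℕ.≤-trans (throws≤arrivals (c ∘ suc) i j) (ℕ.m≤n+m _ _)

-- Height `j` thrown at time `i` lands at `suc (i + j)`, so this forbids landings after time `n`,
-- which is the last coordinate of the root vectors.
LandInTime : ∀ {n} → (Fin n → Throws) → Set
LandInTime {n} c = ∀ i j → n ≤ toℕ i + j → at (c i) j ≡ 0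

landInTime⇒arrivals≡0 : ∀ {n} (c : Fin n → Throws) → LandInTime c →
                        ∀ {p} → n < p → arrivals c p ≡ 0
landInTime⇒arrivals≡0 {zero}  c late≡0 _ = refl
landInTime⇒arrivals≡0 {suc n} c late≡0 {suc p} (s≤s n<p) =
  cong₂ _+_ (late≡0 zero p n<p)
    (landInTime⇒arrivals≡0 (c ∘ suc) (λ i j n≤i+j → late≡0 (suc i) j (s≤s n≤i+j)) n<p)

landInTime⇒net≡0 : ∀ {n} (c : Fin n → Throws) → LandInTime c → ∀ {p} → n < p → net c p ≡ 0ℤ
landInTime⇒net≡0 c late≡0 n<p =
  trans (net-late c (ℕ.<⇒≤ n<p)) (cong (-_ ∘ +_) (landInTime⇒arrivals≡0 c late≡0 n<p))

-- After time `n` no throw can offset a landing. The net flow is then minus a sum of natural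
-- numbers, and if it vanishes, each summand does.
net≡0⇒landInTime : ∀ {n} (c : Fin n → Throws) → (∀ {p} → n < p → net c p ≡ 0ℤ) → LandInTime c
net≡0⇒landInTime c net≡0 i j n≤i+j =
  ℕ.n≤0⇒n≡0 (subst (at (c i) j ≤_) arrivals≡0 (throws≤arrivals c i j))
  where
  arrivals≡0 : arrivals c (suc (toℕ i + j)) ≡ 0
  arrivals≡0 = ℤ.+-injective (ℤ.neg-injective
    (trans (sym (net-late c (ℕ.m≤n⇒m≤1+n n≤i+j))) (net≡0 (s≤s n≤i+j))))

-- Juggling sequences as solutions of the flow equations

-- Height `k` in the state after `n` steps corresponds to time `n + k` on the clock of the initial
-- state.
delay : ℕ → (ℕ → ℤ) → ℕ → ℤ
delay zero    b p       = b p
delay (suc n) b zero    = 0ℤ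
delay (suc n) b (suc p) = delay n b p

delay-⟨_⟩ : ∀ b n p → delay n (entry (b ∷ [])) p ≡ b ℤ.* kron p n
delay-⟨ b ⟩ zero    zero    = sym (ℤ.*-identityʳ b)
delay-⟨ b ⟩ zero    (suc p) = sym (ℤ.*-zeroʳ b)
delay-⟨ b ⟩ (suc n) zero    = sym (ℤ.*-zeroʳ b)
delay-⟨ b ⟩ (suc n) (suc p) = delay-⟨ b ⟩ n p

Drives : ∀ {n} → (Fin n → Throws) → State → State → Set
Drives {n} c a b = ∀ p → net c p ≡ at a p - delay n (at b) p

-- Induction on `n` through the tail of the sequence. Coordinate 0 is the condition `thrown`; at
-- `suc p` the balls that `landed` adds are those that `net-suc` subtracts.
throwsAt-drives : ∀ {a b n} (S : JugglingSeq a b n) → Drives (throwsAt S) a b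
throwsAt-drives {a} {b} {zero} S p =
  sym (trans (cong (_- at b p) (trans (sym (start S p)) (end S p))) (ℤ.+-inverseʳ (at b p)))
throwsAt-drives {a} {b} {suc n} S zero = begin
  net (throwsAt S) 0
    ≡⟨ net-0 (throwsAt S) ⟩
  + total (throwsAt S zero)
    ≡⟨ thrown (step S zero) ⟩
  at (state S zero) 0
    ≡⟨ start S 0 ⟩
  at a 0
    ≡⟨ ℤ.+-identityʳ _ ⟨
  at a 0 - 0ℤ ∎
throwsAt-drives {a} {b} {suc n} S (suc p) = begin
  net (throwsAt S) (suc p)
    ≡⟨ net-suc (throwsAt S) p ⟩
  net (throwsAt S′) p - + c₀
    ≡⟨ cong (_- + c₀) (throwsAt-drives S′ p) ⟩
  at (state S (suc zero)) p - delay n (at b) p - + c₀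
    ≡⟨ cong (λ x → x - delay n (at b) p - + c₀) (landed (step S zero) p) ⟩
  at (state S zero) (suc p) ℤ.+ + c₀ - delay n (at b) p - + c₀
    ≡⟨ cong (λ x → x ℤ.+ + c₀ - delay n (at b) p - + c₀) (start S (suc p)) ⟩
  at a (suc p) ℤ.+ + c₀ - delay n (at b) p - + c₀
    ≡⟨ cancel (at a (suc p)) (+ c₀) (delay n (at b) p) ⟩
  at a (suc p) - delay n (at b) p ∎
  where
  c₀ : ℕ
  c₀ = at (throwsAt S zero) p

  S′ : JugglingSeq (state S (suc zero)) b n
  S′ = record
    { state = state S ∘ suc
    ; start = λ _ → refl
    ; end   = end S
    ; step  = step S ∘ suc
    }

  cancel : ∀ x y z → x ℤ.+ y - z - y ≡ x - z
  cancel = solve-∀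

-- The state forced by `landed`. It is defined for arbitrary throws, so that `states` exists first
-- and `thrown` is checked afterwards.
next : State → Throws → State
next s c = record
  { at      = λ k → at s (suc k) ℤ.+ + at c k
  ; bound   = bound s ⊔ bound c
  ; support = λ k m≤k → cong₂ (λ x y → x ℤ.+ + y)
      (support s (suc k) (ℕ.m≤n⇒m≤1+n (ℕ.m⊔n≤o⇒m≤o _ _ m≤k)))
      (support c k (ℕ.m⊔n≤o⇒n≤o (bound s) _ m≤k))
  }

states : ∀ {n} → State → (Fin n → Throws) → Fin (suc n) → State
states         a c zero    = a
states {suc n} a c (suc i) = states (next a (c zero)) (c ∘ suc) i

landed-states : ∀ {n} a (c : Fin n → Throws) i k →
  at (states a c (suc i)) k ≡ at (states a c (inject₁ i)) (suc k) ℤ.+ + at (c i) k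
landed-states {suc n} a c zero    k = refl
landed-states {suc n} a c (suc i) k = landed-states (next a (c zero)) (c ∘ suc) i k

-- The equations at coordinates `suc p` pass to the tail; the one at coordinate 0 stays behind and
-- yields `thrown`.
drives-suc : ∀ {n} a b (c : Fin (suc n) → Throws) → Drives c a b →
             Drives (c ∘ suc) (next a (c zero)) b
drives-suc {n} a b c drives p = begin
  net (c ∘ suc) p
    ≡⟨ expand _ (+ c₀) ⟩
  net (c ∘ suc) p - + c₀ ℤ.+ + c₀
    ≡⟨ cong (ℤ._+ + c₀) (trans (sym (net-suc c p)) (drives (suc p))) ⟩
  at a (suc p) - delay n (at b) p ℤ.+ + c₀
    ≡⟨ regroup (at a (suc p)) (delay n (at b) p) (+ c₀) ⟩
  at a (suc p) ℤ.+ + c₀ - delay n (at b) p ∎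
  where
  c₀ : ℕ
  c₀ = at (c zero) p

  expand : ∀ x y → x ≡ x - y ℤ.+ y
  expand = solve-∀

  regroup : ∀ x y z → x - y ℤ.+ z ≡ x ℤ.+ z - y
  regroup = solve-∀

thrown-states : ∀ {n} a b (c : Fin n → Throws) → Drives c a b → ∀ i →
                + total (c i) ≡ at (states a c (inject₁ i)) 0
thrown-states {suc n} a b c drives zero =
  trans (sym (net-0 c)) (trans (drives 0) (ℤ.+-identityʳ (at a 0)))
thrown-states {suc n} a b c drives (suc i) =
  thrown-states (next a (c zero)) b (c ∘ suc) (drives-suc a b c drives) i

end-states : ∀ {n} a b (c : Fin n → Throws) → Drives c a b → states a c (fromℕ n) ≋ b
-- With no steps left, the net flow computes to 0 and the equation reads 0 = a - b at height `k`.
end-states {zero}  a b c drives k = ℤ.i-j≡0⇒i≡j (at a k) (at b k) (sym (drives k))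
end-states {suc n} a b c drives   =
  end-states (next a (c zero)) b (c ∘ suc) (drives-suc a b c drives)

juggle : ∀ {a b n} (c : Fin n → Throws) → Drives c a b → JugglingSeq a b n
juggle {a} {b} c drives = record
  { state = states a c
  ; start = λ _ → refl
  ; end   = end-states a b c drives
  ; step  = λ i → record
    { throws = c i
    ; thrown = thrown-states a b c drives i
    ; landed = landed-states a c i
    }
  }

_≐_ : ∀ {n} → (Fin n → Throws) → (Fin n → Throws) → Set
c ≐ d = ∀ i j → at (c i) j ≡ at (d i) j

-- Throws are differences of consecutive states, by `landed`.
≈⇒throwsAt-≐ : ∀ {a b n} (S T : JugglingSeq a b n) → (∀ i → state S i ≋ state T i) →
               throwsAt S ≐ throwsAt T
≈⇒throwsAt-≐ S T S≈T i j = ℤ.+-injective (∙-cancelˡ (at (state S (inject₁ i)) (suc j)) _ _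
  (begin
    at (state S (inject₁ i)) (suc j) ℤ.+ + at (throwsAt S i) j
      ≡⟨ landed (step S i) j ⟨
    at (state S (suc i)) j
      ≡⟨ S≈T (suc i) j ⟩
    at (state T (suc i)) j
      ≡⟨ landed (step T i) j ⟩
    at (state T (inject₁ i)) (suc j) ℤ.+ + at (throwsAt T i) j
      ≡⟨ cong (ℤ._+ _) (S≈T (inject₁ i) (suc j)) ⟨
    at (state S (inject₁ i)) (suc j) ℤ.+ + at (throwsAt T i) j ∎))

throwsAt-≐⇒≈ : ∀ {a b n} (S T : JugglingSeq a b n) → throwsAt S ≐ throwsAt T →
               ∀ i → state S i ≋ state T i
throwsAt-≐⇒≈ S T S≐T = <-weakInduction (λ i → state S i ≋ state T i)
  (λ k → trans (start S k) (sym (start T k)))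
  (λ i Sᵢ≋Tᵢ k → trans (landed (step S i) k)
    (trans (cong₂ (λ x y → x ℤ.+ + y) (Sᵢ≋Tᵢ (suc k)) (S≐T i k)) (sym (landed (step T i) k))))

-- Multisets of roots

-- rootMultiset S is definitionally roots (throwsAt S).
roots : ∀ {r} → (Fin r → Throws) → List (Vec ℤ (suc r))
roots {r} c =
  concatMap (λ i →
    concatMap (λ j → replicate (at (c i) j) (root (toℕ i) (toℕ i + suc j)))
    (upTo (bound (c i))))
  (allFin r)

-- Applied to a coordinate function this computes the sum of the multiset; applied to an indicator,
-- a multiplicity.
sumOf-roots : ∀ {r} (f : Vec ℤ (suc r) → ℤ) (c : Fin r → Throws) →
              sumOf f (roots c) ≡ throwSum (λ i j → f (root i j)) c
sumOf-roots {r} f c = trans (sumOf-concatMap f _ (allFin r))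
  (sumOf-cong (λ i → trans (sumOf-concatMap f _ (upTo (bound (c i))))
    (sumOf-cong (λ j → sumOf-replicate f (at (c i) j) _) (upTo (bound (c i))))) (allFin r))

lookup-sumᵛ-roots : ∀ {r} (c : Fin r → Throws) p → lookup (sumᵛ (roots c)) p ≡ net c (toℕ p)
lookup-sumᵛ-roots c p = begin
  lookup (sumᵛ (roots c)) p
    ≡⟨ lookup-sumᵛ (roots c) p ⟩
  sumOf (λ v → lookup v p) (roots c)
    ≡⟨ sumOf-roots (λ v → lookup v p) c ⟩
  throwSum (λ i j → lookup (root i j) p) c
    ≡⟨ sumOf-cong (λ i → pairing-cong (c i) (λ j → lookup-root (toℕ i) (toℕ i + suc j) p))
         (allFin _) ⟩
  net c (toℕ p) ∎

open module VecMultiplicity {n} = Multiplicity (Vec.≡-dec {n = n} ℤ._≟_)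

i<i+1+j : ∀ i j → i < i + suc j
i<i+1+j i j = ℕ.m<m+n i (s≤s z≤n)

i+j<r⇒i+1+j<1+r : ∀ {r} i j → i + j < r → i + suc j < suc r
i+j<r⇒i+1+j<1+r i j i+j<r rewrite ℕ.+-suc i j = s≤s i+j<r

count-roots : ∀ {r} (c : Fin r → Throws) i j → toℕ i + j < r →
              count (root (toℕ i) (toℕ i + suc j)) (roots c) ≡ at (c i) j
count-roots {r} c i j i+j<r = ℤ.+-injective (begin
  + count v (roots c)
    ≡⟨ sumOf-indicator v (roots c) ⟨
  sumOf (indicator v) (roots c)
    ≡⟨ sumOf-roots (indicator v) c ⟩
  throwSum (λ k l → indicator v (root k l)) c
    ≡⟨ sumOf-cong (λ k → pairing-cong (c k) (indicator-root k)) (allFin r) ⟩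
  throwSum (λ k l → kron (toℕ i) k ℤ.* kron (toℕ i + suc j) l) c
    ≡⟨ throwSum-kron c i j ⟩
  + at (c i) j ∎)
  where
  v : Vec ℤ (suc r)
  v = root (toℕ i) (toℕ i + suc j)

  indices : ∀ {k : Fin r} {l} → v ≡ root (toℕ k) (toℕ k + suc l) →
            toℕ i ≡ toℕ k × toℕ i + suc j ≡ toℕ k + suc l
  indices {k} {l} v≡w
    -- The equation is reversed because the throw to height `l` at time `k` may land past the last
    -- coordinate, and only the first root in `root-injective` may have such an index.
    with k≡i , l≡j ← root-injective (ℕ.m≤n⇒m≤1+n (toℕ<n k)) (i+j<r⇒i+1+j<1+r (toℕ i) j i+j<r)
                       (i<i+1+j (toℕ k) l) (i<i+1+j (toℕ i) j) (sym v≡w)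
    = sym k≡i , sym l≡j

  indicator-root : ∀ (k : Fin r) l → indicator v (root (toℕ k) (toℕ k + suc l)) ≡
                   kron (toℕ i) (toℕ k) ℤ.* kron (toℕ i + suc j) (toℕ k + suc l)
  indicator-root k l with toℕ i ℕ.≟ toℕ k | toℕ i + suc j ℕ.≟ toℕ k + suc l
  ... | yes i≡k | yes j≡l rewrite sym i≡k | sym j≡l = begin
    indicator v v
      ≡⟨ indicator-refl v ⟩
    1ℤ ℤ.* 1ℤ
      ≡⟨ cong₂ ℤ._*_ (kron-refl (toℕ i)) (kron-refl (toℕ i + suc j)) ⟨
    kron (toℕ i) (toℕ i) ℤ.* kron (toℕ i + suc j) (toℕ i + suc j) ∎
  ... | no i≢k  | _       = trans (indicator-≢ (i≢k ∘ proj₁ ∘ indices))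
    (sym (cong (ℤ._* kron (toℕ i + suc j) (toℕ k + suc l)) (kron-≢ i≢k)))
  ... | yes _   | no j≢l  = trans (indicator-≢ (j≢l ∘ proj₂ ∘ indices))
    (sym (trans (cong (ℤ._*_ (kron (toℕ i) (toℕ k))) (kron-≢ j≢l)) (ℤ.*-zeroʳ (kron (toℕ i) (toℕ k)))))

-- Positive roots indexed by time and height. Matching refines the vector to the form that
-- `count-roots` accepts.
data ThrowRoot r : Vec ℤ (suc r) → Set where
  throwRoot : ∀ (i : Fin r) j → toℕ i + j < r → ThrowRoot r (root (toℕ i) (toℕ i + suc j))

Φ⁺⇒throwRoot : ∀ {r v} → Φ⁺ r v → ThrowRoot r v
Φ⁺⇒throwRoot {r} (i , j , i<j , s≤s j≤r , refl) =
  subst₂ (λ i j → ThrowRoot r (root i j)) (toℕ-fromℕ< i<r) j′+k≡j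
    (throwRoot (fromℕ< i<r) k (subst (_≤ r) (trans (sym j′+k≡j) (ℕ.+-suc _ k)) j≤r))
  where
  i<r : i < r
  i<r = ℕ.<-≤-trans i<j j≤r

  k : ℕ
  -- Heights start at 0, so a throw from `i` landing at `j` has height `j - i - 1`.
  k = j ∸ suc i

  j′+k≡j : toℕ (fromℕ< i<r) + suc k ≡ j
  j′+k≡j rewrite toℕ-fromℕ< i<r = trans (ℕ.+-suc i k) (ℕ.m+[n∸m]≡n i<j)

throwRoot⇒Φ⁺ : ∀ {r} (i : Fin r) j → toℕ i + j < r → Φ⁺ r (root (toℕ i) (toℕ i + suc j))
throwRoot⇒Φ⁺ i j i+j<r =
  toℕ i , toℕ i + suc j , i<i+1+j (toℕ i) j , i+j<r⇒i+1+j<1+r (toℕ i) j i+j<r , refl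

roots-Φ⁺ : ∀ {r} (c : Fin r → Throws) → LandInTime c → All (Φ⁺ r) (roots c)
roots-Φ⁺ {r} c late≡0 =
  All.concat⁺ (All.map⁺ (All.tabulate⁺ λ i →
    All.concat⁺ (All.map⁺ (All.applyUpTo⁺₂ id (bound (c i)) (replicate-Φ⁺ i)))))
  where
  replicate-Φ⁺ : ∀ i j → All (Φ⁺ r) (replicate (at (c i) j) (root (toℕ i) (toℕ i + suc j)))
  replicate-Φ⁺ i j with toℕ i + j ℕ.<? r
  ... | yes i+j<r = All.replicate⁺ _ (throwRoot⇒Φ⁺ i j i+j<r)
  -- The vector is not a positive root in this case, but it is repeated zero times.
  ... | no  i+j≮r rewrite late≡0 i j (ℕ.≮⇒≥ i+j≮r) = []

-- Equal throws may carry different bounds, so multiplicities are compared instead of the lists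
-- themselves.
roots-cong : ∀ {r} (c d : Fin r → Throws) → LandInTime c → LandInTime d →
             c ≐ d → roots c ↭ roots d
roots-cong {r} c d c-late≡0 d-late≡0 c≐d =
  count≡⇒↭ (roots-Φ⁺ c c-late≡0) (roots-Φ⁺ d d-late≡0) λ v v∈Φ → go (Φ⁺⇒throwRoot v∈Φ)
  where
  go : ∀ {v} → ThrowRoot r v → count v (roots c) ≡ count v (roots d)
  go (throwRoot i j i+j<r) =
    trans (count-roots c i j i+j<r) (trans (c≐d i j) (sym (count-roots d i j i+j<r)))

roots-injective : ∀ {r} (c d : Fin r → Throws) → LandInTime c → LandInTime d →
                  roots c ↭ roots d → c ≐ d
roots-injective {r} c d c-late≡0 d-late≡0 c↭d i j with toℕ i + j ℕ.<? r
... | yes i+j<r =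
  trans (sym (count-roots c i j i+j<r)) (trans (count-↭ _ c↭d) (count-roots d i j i+j<r))
... | no i+j≮r = trans (c-late≡0 i j (ℕ.≮⇒≥ i+j≮r)) (sym (d-late≡0 i j (ℕ.≮⇒≥ i+j≮r)))

-- Throws recovered from a multiset of positive roots

module Throwing {r} {ps : List (Vec ℤ (suc r))} (ps⊆Φ⁺ : All (Φ⁺ r) ps) where

  multiplicity : ℕ → ℕ → ℕ
  multiplicity i j = count (root i (i + suc j)) ps

  -- The landing index is out of range here, so the vector is just `ε i`, which is not a positive
  -- root.
  late : ∀ (i : Fin r) j → r ≤ toℕ i + j → multiplicity (toℕ i) j ≡ 0
  late i j r≤i+j = count-∉ λ y∈ps v≡y → absurd (All.lookup ps⊆Φ⁺ y∈ps) v≡y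
    where
    absurd : ∀ {y} → Φ⁺ r y → root (toℕ i) (toℕ i + suc j) ≢ y
    absurd (i′ , j′ , i′<j′ , j′≤r , refl) v≡y
      with _ , refl ← root-injective (ℕ.m≤n⇒m≤1+n (toℕ<n i)) j′≤r
                        (i<i+1+j (toℕ i) j) i′<j′ v≡y
      = ℕ.≤⇒≯ (s≤s r≤i+j) (subst (_< suc r) (ℕ.+-suc (toℕ i) j) j′≤r)

  throwing : Fin r → Throws
  throwing i = record
    { at      = multiplicity (toℕ i)
    -- From any time, a throw to height `r` or more lands after time `r`.
    ; bound   = r
    ; support = λ j r≤j → late i j (ℕ.≤-trans r≤j (ℕ.m≤n+m j (toℕ i)))
    }

  roots-throwing : roots throwing ↭ ps
  roots-throwing = count≡⇒↭ (roots-Φ⁺ throwing late) ps⊆Φ⁺ λ v v∈Φ → go (Φ⁺⇒throwRoot v∈Φ)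
    where
    go : ∀ {v} → ThrowRoot r v → count v (roots throwing) ≡ count v ps
    go (throwRoot i j i+j<r) = count-roots throwing i j i+j<r

-- Flow equations and the partition equation

module _ {r s} (s≤1+r : s ≤ suc r) (a : Vec ℤ s) (b : ℤ) where

  drives⇒landInTime : (c : Fin r → Throws) → Drives c ⟨ a ⟩ ⟨ b ∷ [] ⟩ → LandInTime c
  drives⇒landInTime c drives = net≡0⇒landInTime c net≡0
    where
    net≡0 : ∀ {p} → r < p → net c p ≡ 0ℤ
    net≡0 {p} r<p = begin
      net c p
        ≡⟨ drives p ⟩
      entry a p - delay r (entry (b ∷ [])) p
        ≡⟨ cong₂ _-_ (entry-support a p (ℕ.≤-trans s≤1+r r<p)) (delay-⟨ b ⟩ r p) ⟩
      0ℤ - b ℤ.* kron p r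
        ≡⟨ cong (λ x → 0ℤ - b ℤ.* x) (kron-≢ (ℕ.>⇒≢ r<p)) ⟩
      0ℤ - b ℤ.* 0ℤ
        ≡⟨ cong (λ x → 0ℤ - x) (ℤ.*-zeroʳ b) ⟩
      0ℤ ∎

  drives⇒sum≡δ : (c : Fin r → Throws) → Drives c ⟨ a ⟩ ⟨ b ∷ [] ⟩ → sumᵛ (roots c) ≡ δ r a b
  drives⇒sum≡δ c drives = lookup-ext λ p → begin
    lookup (sumᵛ (roots c)) p
      ≡⟨ lookup-sumᵛ-roots c p ⟩
    net c (toℕ p)
      ≡⟨ drives (toℕ p) ⟩
    entry a (toℕ p) - delay r (entry (b ∷ [])) (toℕ p)
      ≡⟨ cong (λ x → entry a (toℕ p) - x) (delay-⟨ b ⟩ r (toℕ p)) ⟩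
    entry a (toℕ p) - b ℤ.* kron (toℕ p) r
      ≡⟨ lookup-δ r a b p ⟨
    lookup (δ r a b) p ∎

  -- The vector equation covers coordinates up to `r`. Beyond them the net flow vanishes by
  -- `LandInTime`, `a` has no entries, and the delayed `b` sits at coordinate `r` alone.
  sum≡δ⇒drives : (c : Fin r → Throws) → LandInTime c → sumᵛ (roots c) ≡ δ r a b →
                 Drives c ⟨ a ⟩ ⟨ b ∷ [] ⟩
  sum≡δ⇒drives c late≡0 sum≡δ p =
    trans net≡ (cong (λ x → entry a p - x) (sym (delay-⟨ b ⟩ r p)))
    where
    in-range : ∀ (q : Fin (suc r)) → net c (toℕ q) ≡ entry a (toℕ q) - b ℤ.* kron (toℕ q) r
    in-range q = trans (sym (lookup-sumᵛ-roots c q))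
      (trans (cong (λ v → lookup v q) sum≡δ) (lookup-δ r a b q))

    net≡ : net c p ≡ entry a p - b ℤ.* kron p r
    net≡ with p ℕ.<? suc r
    ... | yes p<1+r = subst (λ p → net c p ≡ entry a p - b ℤ.* kron p r)
                        (toℕ-fromℕ< p<1+r) (in-range (fromℕ< p<1+r))
    ... | no  p≮1+r
      rewrite landInTime⇒net≡0 c late≡0 (ℕ.≮⇒≥ p≮1+r)
            | entry-support a p (ℕ.≤-trans s≤1+r (ℕ.≮⇒≥ p≮1+r))
            | kron-≢ (ℕ.>⇒≢ (ℕ.≮⇒≥ p≮1+r))
            | ℤ.*-zeroʳ b = refl

mainTheorem3 : (r : ℕ) → 1 ≤ r →
    (s : ℕ) → s ≤ suc r →
    (a : Vec ℤ s) (b₁ : ℤ) → b₁ ≡ sumℤ a →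
    Σ ((S : JugglingSeq ⟨ a ⟩ ⟨ b₁ ∷ [] ⟩ r) →
    IsPartition (Φ⁺ r) (δ r a b₁) (rootMultiset S))
    λ isPartition →
    IsBijection
    (Setoid._≈_ (JS ⟨ a ⟩ ⟨ b₁ ∷ [] ⟩ r))
    (Setoid._≈_ (P (Φ⁺ r) (δ r a b₁)))
    (λ S → rootMultiset S , isPartition S)
mainTheorem3 r _ s s≤1+r a b₁ _ = isPartition , record
  { isInjection = record
    { isCongruent = record
      { cong           = λ {S} {T} → congruent S T
      ; isEquivalence₁ = Setoid.isEquivalence (JS ⟨ a ⟩ ⟨ b₁ ∷ [] ⟩ r)
      ; isEquivalence₂ = Setoid.isEquivalence (P (Φ⁺ r) (δ r a b₁))
      }
    ; injective = λ {S} {T} S↭T → throwsAt-≐⇒≈ S T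
        (roots-injective (throwsAt S) (throwsAt T) (landInTime S) (landInTime T) S↭T)
    }
  ; surjective = λ (ps , ps⊆Φ⁺ , sum≡δ) →
      let open Throwing ps⊆Φ⁺
          S = juggle throwing (sum≡δ⇒drives s≤1+r a b₁ throwing late
                (trans (sumᵛ-↭ roots-throwing) sum≡δ))
      -- Surjectivity between setoids asks about every `T` equivalent to the constructed `S`, hence
      -- the detour through `congruent`.
      in S , λ {T} T≈S → ↭-trans (congruent T S T≈S) roots-throwing
  }
  where
  Sequence : Set
  Sequence = JugglingSeq ⟨ a ⟩ ⟨ b₁ ∷ [] ⟩ r

  landInTime : (S : Sequence) → LandInTime (throwsAt S)
  landInTime S = drives⇒landInTime s≤1+r a b₁ (throwsAt S) (throwsAt-drives S)

  isPartition : (S : Sequence) → IsPartition (Φ⁺ r) (δ r a b₁) (rootMultiset S)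
  isPartition S =
    roots-Φ⁺ (throwsAt S) (landInTime S) ,
    drives⇒sum≡δ s≤1+r a b₁ (throwsAt S) (throwsAt-drives S)

  congruent : (S T : Sequence) → (∀ i → state S i ≋ state T i) →
              rootMultiset S ↭ rootMultiset T
  congruent S T S≈T = roots-cong (throwsAt S) (throwsAt T) (landInTime S) (landInTime T)
    (≈⇒throwsAt-≐ S T S≈T)
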